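{- Let $\mathbb{X}$ be a topological space with viable base $\Omega_0$, and $\mathbb{D}$ a bc-domain with basis $D_0$. Let $\mathcal{W}$ be the rounded ideal completion of $(\mathbb{B}_{\mathrm{abs}},\prec)$. Then $\mathcal{W}$ is order-isomorphic to $[\widehat{\mathbb{X}}_{\Omega_0}\to\mathbb{D}]$.
   Context: A viable base of $\mathbb{X}=(X,\tau_{\mathbb{X}})$ is a family $\Omega_0\subseteq\tau_{\mathbb{X}}$ closed under finite unions and finite intersections (so $\emptyset,X\in\Omega_0$) which is a base of $\tau_{\mathbb{X}}$. $\mathrm{Idl}(\Omega_0)$ is the complete lattice (under inclusion) of ideals (nonempty, downward closed, directed subsets) of $(\Omega_0,\subseteq)$. $\widehat{\mathbb{X}}_{\Omega_0}$ is the set of completely prime filters of $\mathrm{Idl}(\Omega_0)$ (nonempty upward closed sets closed under binary meets such that $\bigvee A\in F\Rightarrow A\cap F\neq\emptyset$), with the topology whose open sets are exactly $\mathcal{O}_I=\{y: I\in y\}$, $I\in\mathrm{Idl}(\Omega_0)$. A bc-domain is a continuous dcpo with least element $\bot$ in which bounded subsets have joins; $\ll$ is way-below; $\twoheaduparrow b=\{d: b\ll d\}$; a basis $D_0$ is a subset such that each $x$ is the directed join of $\{a\in D_0: a\ll x\}$. $[\widehat{\mathbb{X}}_{\Omega_0}\to\mathbb{D}]$ is the set of functions continuous into the Scott topology of $D$, ordered pointwise. $b\chi_O$ has value $b$ on $O$ and $\bot$ elsewhere; a family $\{b_i\chi_{O_i}\}_{i\in I}$ is consistent if for every $J\subseteq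 I$ with $\bigcap_{j\in J}O_j\neq\emptyset$ the $b_j$ ($j\in J$) have an upper bound. $\mathbb{B}_{\mathrm{abs}}$ is the set of functions $X\to D$ of the form $\bigsqcup_{i\in I}b_i\chi_{O_i}$ (pointwise join) with $I$ finite, the family consistent, $O_i\in\Omega_0$, $b_i\in D_0$; on it, $\bigsqcup_{i\in I}b_i\chi_{O_i}\prec h$ iff $O_i\subseteq h^{ -1}(\twoheaduparrow b_i)$ for all $i\in I$. The rounded ideal completion of $(\mathbb{B}_{\mathrm{abs}},\prec)$ is the set of nonempty subsets $R\subseteq\mathbb{B}_{\mathrm{abs}}$ that are $\prec$-downward closed ($h\in R$, $h'\prec h\Rightarrow h'\in R$) and $\prec$-directed (for $h_1,h_2\in R$ there is $h\in R$ with $h_1\prec h$, $h_2\prec h$), ordered by inclusion. -}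

module Defs where

open import Data.Fin.Base using (Fin)
open import Data.Nat.Base using (ℕ)
open import Data.Product.Base using (Σ; ∃; _×_; _,_; proj₁)
open import Data.Sum.Base using (_⊎_)
open import Level using (Level; _⊔_) renaming (suc to lsuc)
open import Relation.Binary.Bundles using (Poset)
open import Relation.Binary.Core using (Rel)
open import Relation.Binary.Definitions using (Minimum; _Respects_)
import Relation.Binary.Construct.On as On
open import Relation.Binary.Morphism.Structures using (IsOrderIsomorphism)
open import Relation.Unary using (Pred; _∈_; _∉_; _⊆_; _≐_; _∩_; _∪_; _≬_; _⊢_; Satisfiable)
open import Relation.Unary.Polymorphic using (∅; U)
open import Relation.Unary.Relation.Binary.Subset using (⊆-poset)

-- Subsets are predicates, and the subsets quantified over below (directed sets,
-- subfamilies, filters, ...) all take truth values in one arbitrary universe `ℓ`.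
-- Under excluded middle every proposition is equivalent to `⊤` or `⊥`, so every
-- subset is ≐ to one with truth values in `Set ℓ`: the choice of `ℓ` is immaterial.
-- This is also why joins and meets in the lattice of ideals are used through their
-- universal properties and not through a construction.

private
  variable
    a r p s t : Level

-- Zorn's lemma stands for the axiom of choice: showing that the spectrum has enough
-- points (prime filters of Ω₀) needs the prime ideal theorem.
Zorn : (c ℓ₁ ℓ₂ ℓ : Level) → Set (lsuc (c ⊔ ℓ₁ ⊔ ℓ₂ ⊔ ℓ))
Zorn c ℓ₁ ℓ₂ ℓ =
  (P : Poset c ℓ₁ ℓ₂) → let open Poset P in
  ((C : Pred Carrier ℓ) →
     (∀ {x y} → x ∈ C → y ∈ C → x ≤ y ⊎ y ≤ x) →
     ∃ λ u → ∀ {x} → x ∈ C → x ≤ u) →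
  ∃ λ m → ∀ {x} → m ≤ x → x ≈ m

Directed : {A : Set a} → Rel A r → Pred A p → Set (a ⊔ r ⊔ p)
Directed _∼_ S =
  Satisfiable S × (∀ {x y} → x ∈ S → y ∈ S → ∃ λ z → z ∈ S × x ∼ z × y ∼ z)

OrderIsomorphic : ∀ {c₁ e₁ l₁ c₂ e₂ l₂} →
  Poset c₁ e₁ l₁ → Poset c₂ e₂ l₂ → Set (c₁ ⊔ e₁ ⊔ l₁ ⊔ c₂ ⊔ e₂ ⊔ l₂)
OrderIsomorphic P Q =
  Σ (P.Carrier → Q.Carrier) (IsOrderIsomorphism P._≈_ Q._≈_ P._≤_ Q._≤_)
  where
  module P = Poset P
  module Q = Poset Q

module _ {c ℓ₁ ℓ₂} (P : Poset c ℓ₁ ℓ₂) where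
  open Poset P

  IsUpperBound : Pred Carrier p → Carrier → Set (c ⊔ ℓ₂ ⊔ p)
  IsUpperBound S u = ∀ {x} → x ∈ S → x ≤ u

  IsJoin : Pred Carrier p → Carrier → Set (c ⊔ ℓ₂ ⊔ p)
  IsJoin S j = IsUpperBound S j × (∀ {u} → IsUpperBound S u → j ≤ u)

  IsMeet : Carrier → Carrier → Carrier → Set (c ⊔ ℓ₂)
  IsMeet x y m = m ≤ x × m ≤ y × (∀ {z} → z ≤ x → z ≤ y → z ≤ m)

  record CompletelyPrimeFilter (ℓ : Level) : Set (c ⊔ ℓ₂ ⊔ lsuc ℓ) where
    field
      member   : Pred Carrier ℓ
      nonempty : Satisfiable member
      upClosed : ∀ {x y} → x ∈ member → x ≤ y → y ∈ member
      ∧-closed : ∀ {x y m} → x ∈ member → y ∈ member → IsMeet x y m → m ∈ member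
      prime    : (A : Pred Carrier ℓ) → ∀ {j} → IsJoin A j → j ∈ member → A ≬ member

record Topology {x} (X : Set x) (ℓ : Level) : Set (x ⊔ lsuc ℓ) where
  field
    Open     : Pred (Pred X ℓ) ℓ
    respects : Open Respects _≐_
    U-open   : U ∈ Open
    ∩-open   : ∀ {V W} → V ∈ Open → W ∈ Open → (V ∩ W) ∈ Open
    -- `⋃ 𝒰` itself lives in a larger universe, hence "every `V` that is the union of `𝒰`"
    ⋃-open   : (𝒰 : Pred (Pred X ℓ) ℓ) → 𝒰 ⊆ Open →
               ∀ {V} → V ≐ (λ x → ∃ λ W → W ∈ 𝒰 × x ∈ W) → V ∈ Open

record IsViableBase {x ℓ} {X : Set x} (τ : Topology X ℓ) (Ω₀ : Pred (Pred X ℓ) ℓ)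
    : Set (x ⊔ lsuc ℓ) where
  open Topology τ
  field
    respects : Ω₀ Respects _≐_
    isOpen   : Ω₀ ⊆ Open
    ∅-mem    : ∅ ∈ Ω₀
    U-mem    : U ∈ Ω₀
    ∪-closed : ∀ {V W} → V ∈ Ω₀ → W ∈ Ω₀ → (V ∪ W) ∈ Ω₀
    ∩-closed : ∀ {V W} → V ∈ Ω₀ → W ∈ Ω₀ → (V ∩ W) ∈ Ω₀
    isBase   : ∀ {V} → V ∈ Open → ∀ {x} → x ∈ V → ∃ λ B → B ∈ Ω₀ × x ∈ B × B ⊆ V

Continuous : ∀ {y z ℓ} {Y : Set y} {Z : Set z} →
  Pred (Pred Y ℓ) s → Pred (Pred Z ℓ) t → (Y → Z) → Set (z ⊔ lsuc ℓ ⊔ s ⊔ t)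
Continuous τY τZ f = ∀ {V} → V ∈ τZ → (f ⊢ V) ∈ τY

module _ {x ℓ} {X : Set x} (Ω₀ : Pred (Pred X ℓ) ℓ) where

  record Ideal : Set (x ⊔ lsuc ℓ) where
    field
      member     : Pred (Pred X ℓ) ℓ
      ⊆Ω₀        : member ⊆ Ω₀
      downClosed : ∀ {V W} → V ∈ member → W ∈ Ω₀ → W ⊆ V → W ∈ member
      directed   : Directed _⊆_ member

  Idl : Poset (x ⊔ lsuc ℓ) (x ⊔ lsuc ℓ) (x ⊔ lsuc ℓ)
  Idl = On.poset (⊆-poset (Pred X ℓ) ℓ) Ideal.member

  Spec : Set (x ⊔ lsuc ℓ)
  Spec = CompletelyPrimeFilter Idl ℓ

  𝒪 : Ideal → Pred Spec ℓ
  𝒪 I y = I ∈ CompletelyPrimeFilter.member y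

  SpecOpen : Pred (Pred Spec ℓ) (x ⊔ lsuc ℓ)
  SpecOpen V = ∃ λ I → V ≐ 𝒪 I

module _ {c ℓ₁ ℓ₂} (D : Poset c ℓ₁ ℓ₂) (ℓ : Level) where
  open Poset D

  WayBelow : Rel Carrier (c ⊔ ℓ₂ ⊔ lsuc ℓ)
  WayBelow x y = (S : Pred Carrier ℓ) → Directed _≤_ S →
    ∀ {j} → IsJoin D S j → y ≤ j → ∃ λ d → d ∈ S × x ≤ d

  ScottOpen : Pred (Pred Carrier ℓ) (c ⊔ ℓ₂ ⊔ lsuc ℓ)
  ScottOpen V =
    (∀ {x y} → x ∈ V → x ≤ y → y ∈ V) ×
    ((S : Pred Carrier ℓ) → Directed _≤_ S → ∀ {j} → IsJoin D S j → j ∈ V → S ≬ V)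

  IsBasis : Pred Carrier ℓ → Set (c ⊔ ℓ₁ ⊔ ℓ₂ ⊔ lsuc ℓ)
  IsBasis D₀ = D₀ Respects _≈_ ×
    (∀ x → let S = λ a → a ∈ D₀ × WayBelow a x in Directed _≤_ S × IsJoin D S x)

  record IsBCDomain : Set (c ⊔ ℓ₁ ⊔ ℓ₂ ⊔ lsuc ℓ) where
    field
      dcpo        : (S : Pred Carrier ℓ) → Directed _≤_ S → ∃ (IsJoin D S)
      continuous  : IsBasis U
      ⊥           : Carrier
      ⊥-minimum   : Minimum _≤_ ⊥
      boundedJoin : (S : Pred Carrier ℓ) → ∃ (IsUpperBound D S) → ∃ (IsJoin D S)

-- The continuous functions from Spec Ω₀ to the Scott topology, ordered pointwise.
-- Such a function automatically identifies ≐ filters, because the Scott topology is T₀.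
FunctionSpace : ∀ {x ℓ c ℓ₁ ℓ₂} {X : Set x} (Ω₀ : Pred (Pred X ℓ) ℓ) (D : Poset c ℓ₁ ℓ₂) →
  Poset (x ⊔ c ⊔ ℓ₂ ⊔ lsuc ℓ) (x ⊔ ℓ₁ ⊔ lsuc ℓ) (x ⊔ ℓ₂ ⊔ lsuc ℓ)
FunctionSpace {ℓ = ℓ} Ω₀ D = record
  { Carrier        = Σ (Spec Ω₀ → Carrier) (Continuous (SpecOpen Ω₀) (ScottOpen D ℓ))
  ; _≈_            = λ f g → ∀ y → proj₁ f y ≈ proj₁ g y
  ; _≤_            = λ f g → ∀ y → proj₁ f y ≤ proj₁ g y
  ; isPartialOrder = record
    { isPreorder = record
      { isEquivalence = record
        { refl  = λ _ → Eq.refl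
        ; sym   = λ p y → Eq.sym (p y)
        ; trans = λ p q y → Eq.trans (p y) (q y)
        }
      ; reflexive = λ p y → reflexive (p y)
      ; trans     = λ p q y → trans (p y) (q y)
      }
    ; antisym = λ p q y → antisym (p y) (q y)
    }
  }
  where open Poset D

module _ {x ℓ c ℓ₁ ℓ₂} {X : Set x} (Ω₀ : Pred (Pred X ℓ) ℓ)
         (D : Poset c ℓ₁ ℓ₂) (bc : IsBCDomain D ℓ) (D₀ : Pred (Poset.Carrier D) ℓ) where
  open Poset D
  open IsBCDomain bc

  -- h is the function b χ_O; given as a relation since z ∈ O need not be decidable here
  IsStep : Carrier → Pred X ℓ → (X → Carrier) → Set (x ⊔ ℓ₁ ⊔ ℓ)
  IsStep b O h = ∀ z → (z ∈ O → h z ≈ b) × (z ∉ O → h z ≈ ⊥)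

  Consistent : ∀ {n} → (Fin n → Carrier) → (Fin n → Pred X ℓ) → Set (x ⊔ c ⊔ ℓ₂ ⊔ lsuc ℓ)
  Consistent {n} b O = (J : Pred (Fin n) ℓ) →
    (∃ λ z → ∀ {j} → j ∈ J → z ∈ O j) →
    ∃ λ u → ∀ {j} → j ∈ J → b j ≤ u

  record Presentation (g : X → Carrier) : Set (x ⊔ c ⊔ ℓ₁ ⊔ ℓ₂ ⊔ lsuc ℓ) where
    field
      size       : ℕ
      b          : Fin size → Carrier
      O          : Fin size → Pred X ℓ
      b∈D₀       : ∀ i → b i ∈ D₀
      O∈Ω₀       : ∀ i → O i ∈ Ω₀
      consistent : Consistent b O
      bχO        : Fin size → X → Carrier
      isStep     : ∀ i → IsStep (b i) (O i) (bχO i)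
      isJoin     : ∀ z → IsJoin D (λ d → ∃ λ i → d ≈ bχO i z) (g z)

  𝔹abs : Pred (X → Carrier) (x ⊔ c ⊔ ℓ₁ ⊔ ℓ₂ ⊔ lsuc ℓ)
  𝔹abs = Presentation

  -- The condition does not depend on the presentation of g: elements way below a
  -- given one are closed under existing finite joins and downward closed, so it says
  -- that g z is way below h z for all z.
  _≺_ : Rel (X → Carrier) (x ⊔ c ⊔ ℓ₁ ⊔ ℓ₂ ⊔ lsuc ℓ)
  g ≺ h = Σ (Presentation g) λ P → let open Presentation P in
    ∀ i → O i ⊆ (h ⊢ WayBelow D ℓ (b i))

  record RoundedIdeal : Set (x ⊔ c ⊔ ℓ₁ ⊔ ℓ₂ ⊔ lsuc ℓ) where
    field
      member     : Pred (X → Carrier) ℓ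
      ⊆𝔹abs      : member ⊆ 𝔹abs
      downClosed : ∀ {h h′} → h ∈ member → h′ ≺ h → h′ ∈ member
      directed   : Directed _≺_ member

  RoundedIdealCompletion : Poset (x ⊔ c ⊔ ℓ₁ ⊔ ℓ₂ ⊔ lsuc ℓ) (x ⊔ c ⊔ ℓ) (x ⊔ c ⊔ ℓ)
  RoundedIdealCompletion = On.poset (⊆-poset (X → Carrier) ℓ) RoundedIdeal.member

{-# OPTIONS --safe #-}

-- A rounded ideal R is sent to the function whose value at a point y is the directed join of
-- all u such that u ≤ g on V for some g ∈ R and some V ∈ Ω₀ lying in the prime filter y;
-- conversely f is sent to the ⊔ bᵢ χ_{Oᵢ} such that bᵢ ≪ f y whenever y contains Oᵢ.
-- Step functions on X and on the spectrum are compared by a density argument: given a prime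
-- filter y, a member W of y and a finite family in Ω₀, some z ∈ W lies in no member of the
-- family outside y.
-- The prime ideal theorem makes the basic open sets of the spectrum compact, so that a
-- way-below relation holding at all points of one of them is witnessed by a single element
-- of a directed family of step functions.
module Submission where

open import Axiom.ExcludedMiddle using (ExcludedMiddle)
open import Data.Bool.Base using (if_then_else_)
open import Data.Empty using (⊥-elim)
open import Data.Fin.Base using (Fin; zero; suc)
open import Data.List.Base using (List; []; _∷_; _++_; length; lookup)
open import Data.List.Membership.Propositional using () renaming (_∈_ to _∈ˡ_)
open import Data.List.Membership.Propositional.Properties using (∈-lookup)
open import Data.List.Relation.Binary.Subset.Propositional using () renaming (_⊆_ to _⊆ˡ_)
open import Data.List.Relation.Binary.Subset.Propositional.Properties using (xs⊆xs++ys; xs⊆ys++xs)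
open import Data.List.Relation.Unary.Any using (here; index)
open import Data.List.Relation.Unary.Any.Properties using (lookup-index)
open import Data.Nat.Base using (zero; suc)
open import Data.Product.Base using (Σ; ∃; _×_; _,_; proj₁; proj₂; map₂)
open import Data.Sum.Base using (_⊎_; inj₁; inj₂; [_,_]; [_,_]′)
open import Function.Base using (_∘_; id)
open import Level using (Level; _⊔_)
open import Relation.Binary.Bundles using (Poset)
open import Relation.Binary.Core using (Rel)
import Relation.Binary.Construct.On as On
open import Relation.Binary.PropositionalEquality as ≡ using (_≡_)
open import Relation.Nullary using (¬_; yes; no; does)
open import Relation.Nullary.Decidable using (True; toWitness; fromWitness; decidable-stable)
open import Relation.Unary using (Pred; _∈_; _∉_; _⊆_; _≐_; _∩_; _∪_; _≬_; _⊢_)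
open import Relation.Unary.Polymorphic using (∅; U)
open import Defs

private
  variable
    a p q r : Level

-- A witness for index zero and one for the remaining indices have a common upper bound in `S`,
-- where monotonicity preserves all the conditions.
finite-selection : {A : Set a} {_∼_ : Rel A r} {S : Pred A p} → Directed _∼_ S →
  ∀ {n} (P : Fin n → Pred A q) → (∀ {i s t} → s ∼ t → s ∈ P i → t ∈ P i) →
  (∀ i → S ≬ P i) → ∃ λ s → s ∈ S × (∀ i → s ∈ P i)
finite-selection ((s , s∈S) , _) {zero} P mono some = s , s∈S , λ ()
finite-selection dir@(_ , bound) {suc n} P mono some
  with s , s∈S , Ps ← some zero
     | t , t∈S , Pt ← finite-selection dir (P ∘ suc) mono (some ∘ suc)
  with u , u∈S , s∼u , t∼u ← bound s∈S t∈S
  = u , u∈S , λ { zero → mono s∼u Ps ; (suc i) → mono t∼u (Pt i) }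

-- Excluded middle and propositional resizing.

module Classical (em : ∀ {ℓ} → ExcludedMiddle ℓ) where

  -- Propositional resizing: excluded middle moves every proposition to every universe.
  record Small (ℓ : Level) (A : Set a) : Set ℓ where
    constructor small
    field decided : True (em {P = A})

  shrink : ∀ {ℓ} {A : Set a} → A → Small ℓ A
  shrink = small ∘ fromWitness

  unshrink : ∀ {ℓ} {A : Set a} → Small ℓ A → A
  unshrink = toWitness ∘ Small.decided

  by-contradiction : {A : Set a} → ¬ ¬ A → A
  by-contradiction = decidable-stable em

  ⊈-witness : {A : Set a} {P : Pred A p} {Q : Pred A q} → ¬ (P ⊆ Q) → ∃ λ z → z ∈ P × z ∉ Q
  ⊈-witness P⊈Q = by-contradiction λ none →
    P⊈Q λ z∈P → by-contradiction λ z∉Q → none (_ , z∈P , z∉Q)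

  -- Ideals of the viable base and completely prime filters.

  module Spectrum {x ℓ} {X : Set x} {τ : Topology X ℓ} {Ω₀ : Pred (Pred X ℓ) ℓ}
                  (viable : IsViableBase τ Ω₀) where
    open IsViableBase viable
    open Poset (Idl Ω₀) using (_≤_)
    open CompletelyPrimeFilter using (member; upClosed; ∧-closed; prime)

    private
      variable
        V W O : Pred X ℓ
        I : Ideal Ω₀

    _∈ᴵ_ : Pred X ℓ → Ideal Ω₀ → Set ℓ
    V ∈ᴵ I = V ∈ Ideal.member I

    _∉ᴵ_ : Pred X ℓ → Ideal Ω₀ → Set ℓ
    V ∉ᴵ I = V ∉ Ideal.member I

    -- `P` may live in any universe, since `Small` brings its truth values to `ℓ`; closure under
    -- unions supplies directedness.
    ideal : (P : Pred (Pred X ℓ) p) →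
      (∀ {V W} → V ∈ Ω₀ → W ∈ Ω₀ → W ⊆ V → P V → P W) → P ∅ →
      (∀ {V W} → V ∈ Ω₀ → W ∈ Ω₀ → P V → P W → P (V ∪ W)) → Ideal Ω₀
    ideal P down empty union = record
      { member     = λ V → V ∈ Ω₀ × Small ℓ (P V)
      ; ⊆Ω₀        = proj₁
      ; downClosed = λ (v , Pv) w W⊆V → w , shrink (down v w W⊆V (unshrink Pv))
      ; directed   = (∅ , ∅-mem , shrink empty) ,
          λ (v , Pv) (w , Pw) → _ ,
            (∪-closed v w , shrink (union v w (unshrink Pv) (unshrink Pw))) , inj₁ , inj₂
      }

    ∅∈ᴵ : (I : Ideal Ω₀) → ∅ ∈ᴵ I
    ∅∈ᴵ I = Ideal.downClosed I (proj₂ (proj₁ (Ideal.directed I))) ∅-mem λ ()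

    ∪∈ᴵ : (I : Ideal Ω₀) → V ∈ᴵ I → W ∈ᴵ I → (V ∪ W) ∈ᴵ I
    ∪∈ᴵ I V∈I W∈I with Z , Z∈I , V⊆Z , W⊆Z ← proj₂ (Ideal.directed I) V∈I W∈I =
      Ideal.downClosed I Z∈I (∪-closed (Ideal.⊆Ω₀ I V∈I) (Ideal.⊆Ω₀ I W∈I)) [ V⊆Z , W⊆Z ]

    ↓_ : V ∈ Ω₀ → Ideal Ω₀
    ↓_ {V} _ = ideal (_⊆ V) (λ _ _ W⊆V V⊆ z → V⊆ (W⊆V z)) (λ ())
      λ _ _ V⊆ W⊆ → [ V⊆ , W⊆ ]

    ∈↓ : (v : V ∈ Ω₀) → V ∈ᴵ (↓ v)
    ∈↓ v = v , shrink id

    ↓≤ : (v : V ∈ Ω₀) → V ∈ᴵ I → (↓ v) ≤ I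
    ↓≤ {I = I} v V∈I (w , W⊆V) = Ideal.downClosed I V∈I w (unshrink W⊆V)

    ↓-mono : (v : V ∈ Ω₀) (w : W ∈ Ω₀) → V ⊆ W → (↓ v) ≤ (↓ w)
    ↓-mono v w V⊆W = ↓≤ {I = ↓ w} v (v , shrink V⊆W)

    -- y lies in the compact open set of the spectrum that extends V
    _∋_ : Spec Ω₀ → V ∈ Ω₀ → Set ℓ
    y ∋ v = 𝒪 Ω₀ (↓ v) y

    module _ (y : Spec Ω₀) where

      ∋-mono : (v : V ∈ Ω₀) (w : W ∈ Ω₀) → V ⊆ W → y ∋ v → y ∋ w
      ∋-mono v w V⊆W y∋v = upClosed y y∋v (↓-mono v w V⊆W)

      ∋-∩ : (v : V ∈ Ω₀) (w : W ∈ Ω₀) → y ∋ v → y ∋ w → y ∋ ∩-closed v w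
      ∋-∩ v w y∋v y∋w = ∧-closed y y∋v y∋w
        ( ↓-mono (∩-closed v w) v proj₁
        , ↓-mono (∩-closed v w) w proj₂
        , λ ≤v ≤w K∈ → proj₁ (≤v K∈) ,
            shrink λ z → unshrink (proj₂ (≤v K∈)) z , unshrink (proj₂ (≤w K∈)) z)

      -- The principal ideal of `∅` is the join of the empty family, from which complete primeness
      -- could select nothing.
      ∌-∅ : ¬ (y ∋ ∅-mem)
      ∌-∅ y∋∅ with _ , () , _ ← prime y ∅ ((λ ()) , λ {u} _ → ↓≤ {I = u} ∅-mem (∅∈ᴵ u)) y∋∅

      -- The principal ideal of `V ∪ W` is the join of the ideals lying below that of `V` or that of
      -- `W`, so complete primeness finds one of these in `y`.
      ∋-∪ : (v : V ∈ Ω₀) (w : W ∈ Ω₀) → y ∋ ∪-closed v w → y ∋ v ⊎ y ∋ w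
      ∋-∪ {V} {W} v w y∋v∪w = conclude (prime y below ((λ {I} → upper {I}) , λ {u} → least u) y∋v∪w)
        where
        below : Pred (Ideal Ω₀) ℓ
        below I = Small ℓ (I ≤ (↓ v) ⊎ I ≤ (↓ w))

        upper : IsUpperBound (Idl Ω₀) below (↓ ∪-closed v w)
        upper I∈ K∈I with unshrink I∈
        ... | inj₁ I≤v = ↓-mono v (∪-closed v w) inj₁ (I≤v K∈I)
        ... | inj₂ I≤w = ↓-mono w (∪-closed v w) inj₂ (I≤w K∈I)

        least : ∀ u → IsUpperBound (Idl Ω₀) below u → (↓ ∪-closed v w) ≤ u
        least u ub = ↓≤ {I = u} (∪-closed v w) (∪∈ᴵ u
          (ub {↓ v} (shrink (inj₁ id)) (∈↓ v)) (ub {↓ w} (shrink (inj₂ id)) (∈↓ w)))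

        conclude : below ≬ member y → y ∋ v ⊎ y ∋ w
        conclude (I , I∈ , I∈y) with unshrink I∈
        ... | inj₁ I≤v = inj₁ (upClosed y I∈y I≤v)
        ... | inj₂ I≤w = inj₂ (upClosed y I∈y I≤w)

      -- `I` is the join of the principal ideals of its members.
      ∋-basic : (I : Ideal Ω₀) → I ∈ member y → ∃ λ V → V ∈ᴵ I × Σ (V ∈ Ω₀) (y ∋_)
      ∋-basic I I∈y
        with prime y (λ J → Small ℓ (∃ λ V → V ∈ᴵ I × Σ (V ∈ Ω₀) λ v → J ≤ (↓ v)))
               ( (λ J∈ K∈J → let V , V∈I , v , J≤v = unshrink J∈ in ↓≤ {I = I} v V∈I (J≤v K∈J))
               , λ ub K∈I → let k = Ideal.⊆Ω₀ I K∈I in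
                   ub {↓ k} (shrink (_ , K∈I , k , id)) (∈↓ k))
               I∈y
      ... | J , J∈ , J∈y with V , V∈I , v , J≤v ← unshrink J∈ = V , V∈I , v , upClosed y J∈y J≤v

      -- W is not covered by V and the O i outside y, since y is a prime filter. The induction
      -- moves these O i into V.
      patch-dense : ∀ {n} (O : Fin n → Pred X ℓ) (o : ∀ i → O i ∈ Ω₀) (w : W ∈ Ω₀) → y ∋ w →
        (v : V ∈ Ω₀) → ¬ (y ∋ v) →
        ∃ λ z → z ∈ W × z ∉ V × (∀ i → z ∈ O i → y ∋ o i)
      patch-dense {n = zero} O o w y∋w v y∌v
        with z , z∈W , z∉V ← ⊈-witness (λ W⊆V → y∌v (∋-mono w v W⊆V y∋w))
        = z , z∈W , z∉V , λ ()
      patch-dense {n = suc n} O o w y∋w v y∌v with em {P = y ∋ o zero}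
      ... | yes y∋o
        with z , z∈W , z∉V , rest ← patch-dense (O ∘ suc) (o ∘ suc) w y∋w v y∌v
        = z , z∈W , z∉V , λ { zero _ → y∋o ; (suc i) → rest i }
      ... | no y∌o
        with z , z∈W , z∉ , rest ← patch-dense (O ∘ suc) (o ∘ suc) w y∋w
               (∪-closed v (o zero)) ([ y∌v , y∌o ] ∘ ∋-∪ v (o zero))
        = z , z∈W , z∉ ∘ inj₁ , λ { zero z∈O → ⊥-elim (z∉ (inj₂ z∈O)) ; (suc i) → rest i }

    -- Prime ideals as points of the spectrum.

    record IsPrime (J : Ideal Ω₀) : Set (x ⊔ Level.suc ℓ) where
      field
        proper : U ∉ᴵ J
        split  : V ∈ Ω₀ → W ∈ Ω₀ → (V ∩ W) ∈ᴵ J → V ∈ᴵ J ⊎ W ∈ᴵ J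

    -- This is the filter of ideals not contained in `J`; it is completely prime because the join of
    -- ideals inside `J` stays inside `J`.
    point : ∀ {J} → IsPrime J → Spec Ω₀
    point {J} J-prime = record
      { member   = λ K → Small ℓ (∃ λ V → V ∈ᴵ K × V ∉ᴵ J)
      ; nonempty = ↓ U-mem , shrink (U , ∈↓ U-mem , IsPrime.proper J-prime)
      ; upClosed = λ K∈ K≤L → let V , V∈K , V∉J = unshrink K∈ in shrink (V , K≤L V∈K , V∉J)
      ; ∧-closed = λ {K} {L} K∈ L∈ (_ , _ , greatest) →
          let V , V∈K , V∉J = unshrink K∈
              W , W∈L , W∉J = unshrink L∈
              v = Ideal.⊆Ω₀ K V∈K
              w = Ideal.⊆Ω₀ L W∈L
              vw = ∩-closed v w
          in shrink ( V ∩ W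
                    , greatest {↓ vw}
                        (↓≤ {I = K} vw (Ideal.downClosed K V∈K vw proj₁))
                        (↓≤ {I = L} vw (Ideal.downClosed L W∈L vw proj₂)) (∈↓ vw)
                    , [ V∉J , W∉J ] ∘ IsPrime.split J-prime v w)
      ; prime    = λ A (_ , least) j∈ → let V , V∈j , V∉J = unshrink j∈ in
          by-contradiction λ A≬̸ → V∉J (least {J}
            (λ {K} K∈A W∈K → by-contradiction λ W∉J → A≬̸ (K , K∈A , shrink (_ , W∈K , W∉J)))
            V∈j)
      }

    point-∋ : ∀ {J} (J-prime : IsPrime J) (v : V ∈ Ω₀) → V ∉ᴵ J → point J-prime ∋ v
    point-∋ J-prime v V∉J = shrink (_ , ∈↓ v , V∉J)

    -- Its complement in `Ω₀` is the filter of basic neighbourhoods of `z`, so `η` below is the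
    -- canonical map from `X` to its spectrum.
    missing : X → Ideal Ω₀
    missing z = ideal (z ∉_) (λ _ _ W⊆V z∉V → z∉V ∘ W⊆V) (λ ()) (λ _ _ z∉V z∉W → [ z∉V , z∉W ])

    missing-prime : (z : X) → IsPrime (missing z)
    missing-prime z = record
      { proper = λ (_ , z∉U) → unshrink z∉U _
      ; split  = λ {V} v w (_ , z∉) → split′ v w (unshrink z∉)
      }
      where
      split′ : V ∈ Ω₀ → W ∈ Ω₀ → z ∉ (V ∩ W) → V ∈ᴵ missing z ⊎ W ∈ᴵ missing z
      split′ {V} v w z∉ with em {P = z ∈ V}
      ... | yes z∈V = inj₂ (w , shrink λ z∈W → z∉ (z∈V , z∈W))
      ... | no z∉V = inj₁ (v , shrink z∉V)

    η : X → Spec Ω₀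
    η z = point (missing-prime z)

    η-∋ : ∀ {z} (v : V ∈ Ω₀) → z ∈ V → η z ∋ v
    η-∋ {z = z} v z∈V = point-∋ (missing-prime z) v λ (_ , z∉V) → unshrink z∉V z∈V

    -- The witness is the ideal of basic sets whose extension to the spectrum lies in `P`; `∋-∪`
    -- closes it under unions.
    openFromBasic : (P : Pred (Spec Ω₀) p) →
      (∀ {y} → y ∈ P → ∃ λ V → Σ (V ∈ Ω₀) λ v → y ∋ v × (∀ {y′} → y′ ∋ v → y′ ∈ P)) →
      ∃ λ I → P ≐ 𝒪 Ω₀ I
    openFromBasic P local = interior , toI , fromI
      where
      interior : Ideal Ω₀
      interior = ideal (λ V → Σ (V ∈ Ω₀) λ v → ∀ {y} → y ∋ v → y ∈ P)
        (λ v w W⊆V (_ , v⊆P) → w , λ {y} y∋w → v⊆P (∋-mono y w v W⊆V y∋w))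
        (∅-mem , λ {y} y∋∅ → ⊥-elim (∌-∅ y y∋∅))
        (λ v w (_ , v⊆P) (_ , w⊆P) → ∪-closed v w , λ {y} y∋ → [ v⊆P {y} , w⊆P {y} ]′ (∋-∪ y v w y∋))

      toI : P ⊆ 𝒪 Ω₀ interior
      toI {y} y∈P =
        let _ , v , y∋v , v⊆P = local y∈P in
        upClosed y y∋v (↓≤ {I = interior} v (v , shrink (v , λ {y′} → v⊆P {y′})))

      fromI : 𝒪 Ω₀ interior ⊆ P
      fromI {y} y∈ =
        let _ , (_ , V⊆P) , v , y∋v = ∋-basic y interior y∈
            _ , v⊆P = unshrink V⊆P
        in v⊆P {y} y∋v

    basicInOpen : {P : Pred (Spec Ω₀) p} → ∃ (λ I → P ≐ 𝒪 Ω₀ I) → ∀ {y} → y ∈ P →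
      ∃ λ V → Σ (V ∈ Ω₀) λ v → y ∋ v × (∀ {y′} → y′ ∋ v → y′ ∈ P)
    basicInOpen (I , P⊆ , ⊆P) {y} y∈P with V , V∈I , v , y∋v ← ∋-basic y I (P⊆ y∈P) =
      V , v , y∋v , λ {y′} y′∋v → ⊆P (upClosed y′ y′∋v (↓≤ {I = I} v V∈I))

    -- The prime ideal theorem and compactness.

    module _ (zorn : ∀ {c ℓ₁ ℓ₂ ℓ} → Zorn c ℓ₁ ℓ₂ ℓ) where

      -- Zorn's lemma yields a maximal ideal among those containing `I` and avoiding `O`, and
      -- distributivity makes it prime.
      prime-ideal : (I : Ideal Ω₀) (o : O ∈ Ω₀) → O ∉ᴵ I → ∃ λ J → I ≤ J × O ∉ᴵ J × IsPrime J
      prime-ideal {O} I o O∉I = J , I≤J , O∉J , record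
        { proper = λ U∈J → O∉J (Ideal.downClosed J U∈J o _)
        ; split  = split
        }
        where
        Avoider : Set _
        Avoider = Σ (Ideal Ω₀) λ J → I ≤ J × O ∉ᴵ J

        Avoiding : Poset _ _ _
        Avoiding = On.poset (Idl Ω₀) λ (J : Avoider) → proj₁ J

        open Poset Avoiding using () renaming (_≤_ to _≼_; _≈_ to _≈ᴬ_)

        module _ (C : Pred Avoider ℓ) (chain : ∀ {J K} → J ∈ C → K ∈ C → J ≼ K ⊎ K ≼ J) where

          _⊲_ : Pred X ℓ → Avoider → Set _
          V ⊲ J = J ∈ C × V ∈ᴵ proj₁ J

          ⋃C : Ideal Ω₀
          -- The disjunct `V ∈ᴵ I` handles the empty chain, whose union becomes `I`.
          ⋃C = ideal (λ V → V ∈ᴵ I ⊎ ∃ (V ⊲_))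
            (λ { _ w W⊆V (inj₁ V∈I) → inj₁ (Ideal.downClosed I V∈I w W⊆V)
               ; _ w W⊆V (inj₂ (J , J∈C , V∈J)) →
                   inj₂ (J , J∈C , Ideal.downClosed (proj₁ J) V∈J w W⊆V) })
            (inj₁ (∅∈ᴵ I))
            λ _ _ → union
            where
            union : V ∈ᴵ I ⊎ ∃ (V ⊲_) → W ∈ᴵ I ⊎ ∃ (W ⊲_) → (V ∪ W) ∈ᴵ I ⊎ ∃ ((V ∪ W) ⊲_)
            union (inj₁ V∈I) (inj₁ W∈I) = inj₁ (∪∈ᴵ I V∈I W∈I)
            union (inj₁ V∈I) (inj₂ (K , K∈C , W∈K)) =
              inj₂ (K , K∈C , ∪∈ᴵ (proj₁ K) (proj₁ (proj₂ K) V∈I) W∈K)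
            union (inj₂ (J , J∈C , V∈J)) (inj₁ W∈I) =
              inj₂ (J , J∈C , ∪∈ᴵ (proj₁ J) V∈J (proj₁ (proj₂ J) W∈I))
            union (inj₂ (J , J∈C , V∈J)) (inj₂ (K , K∈C , W∈K)) with chain J∈C K∈C
            ... | inj₁ J≼K = inj₂ (K , K∈C , ∪∈ᴵ (proj₁ K) (J≼K V∈J) W∈K)
            ... | inj₂ K≼J = inj₂ (J , J∈C , ∪∈ᴵ (proj₁ J) V∈J (K≼J W∈K))

          upper-bound : ∃ λ u → ∀ {J} → J ∈ C → J ≼ u
          upper-bound =
            ( ⋃C
            , (λ V∈I → Ideal.⊆Ω₀ I V∈I , shrink (inj₁ V∈I))
            , λ (_ , O∈) → [ O∉I , (λ (J , _ , O∈J) → proj₂ (proj₂ J) O∈J) ] (unshrink O∈) )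
            , λ {J} J∈C V∈J → Ideal.⊆Ω₀ (proj₁ J) V∈J , shrink (inj₂ (J , J∈C , V∈J))

        maximal : ∃ λ m → ∀ {K} → m ≼ K → K ≈ᴬ m
        maximal = zorn Avoiding upper-bound

        J : Ideal Ω₀
        J = proj₁ (proj₁ maximal)

        I≤J : I ≤ J
        I≤J = proj₁ (proj₂ (proj₁ maximal))

        O∉J : O ∉ᴵ J
        O∉J = proj₂ (proj₂ (proj₁ maximal))

        J+_ : V ∈ Ω₀ → Ideal Ω₀
        J+_ {V} v = ideal (λ W → ∃ λ A → A ∈ᴵ J × W ⊆ (A ∪ V))
          (λ _ _ W⊆ (A , A∈J , ⊆A) → A , A∈J , λ z → ⊆A (W⊆ z))
          (∅ , ∅∈ᴵ J , λ ())
          λ _ _ (A , A∈J , ⊆A) (B , B∈J , ⊆B) → A ∪ B , ∪∈ᴵ J A∈J B∈J ,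
            [ (λ z → [ inj₁ ∘ inj₁ , inj₂ ] (⊆A z)) , (λ z → [ inj₁ ∘ inj₂ , inj₂ ] (⊆B z)) ]

        -- Otherwise the ideal generated by `J` and `V` would still avoid `O`, and maximality would
        -- put `V` in `J`.
        cover : V ∈ Ω₀ → V ∉ᴵ J → ∃ λ A → A ∈ᴵ J × O ⊆ (A ∪ V)
        cover v V∉J = by-contradiction λ uncovered → V∉J (proj₁
          (proj₂ maximal
            {(J+ v) , (λ W∈I → J≤J+ (I≤J W∈I)) , λ (_ , O∈) → uncovered (unshrink O∈)} J≤J+)
          (v , shrink (∅ , ∅∈ᴵ J , inj₂)))
          where
          J≤J+ : J ≤ (J+ v)
          J≤J+ W∈J = Ideal.⊆Ω₀ J W∈J , shrink (_ , W∈J , inj₁)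

        split : V ∈ Ω₀ → W ∈ Ω₀ → (V ∩ W) ∈ᴵ J → V ∈ᴵ J ⊎ W ∈ᴵ J
        split {V} {W} v w V∩W∈J with em {P = V ∈ᴵ J} | em {P = W ∈ᴵ J}
        ... | yes V∈J | _ = inj₁ V∈J
        ... | _ | yes W∈J = inj₂ W∈J
        ... | no V∉J | no W∉J with A , A∈J , O⊆A ← cover v V∉J | B , B∈J , O⊆B ← cover w W∉J =
          -- By distributivity, `(A ∪ V) ∩ (B ∪ W)` is contained in `A ∪ B ∪ (V ∩ W)`, a union of
          -- three members of `J`.
          ⊥-elim (O∉J (Ideal.downClosed J (∪∈ᴵ J (∪∈ᴵ J A∈J B∈J) V∩W∈J) o λ z∈O →
            [ inj₁ ∘ inj₁
            , (λ z∈V → [ inj₁ ∘ inj₂ , (λ z∈W → inj₂ (z∈V , z∈W)) ] (O⊆B z∈O)) ] (O⊆A z∈O)))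

      -- If `O` were not in `I`, a prime ideal extending `I` and avoiding `O` would give a point in
      -- the extension of `O` whose filter does not contain `I`.
      enough-points : (I : Ideal Ω₀) (o : O ∈ Ω₀) → (∀ y → y ∋ o → I ∈ member y) → O ∈ᴵ I
      enough-points I o o⊆I = by-contradiction λ O∉I →
        let J , I≤J , O∉J , J-prime = prime-ideal I o O∉I
            V , V∈I , V∉J = unshrink (o⊆I (point J-prime) (point-∋ J-prime o O∉J))
        in V∉J (I≤J V∈I)

      -- Directedness of `S` makes the basic sets contained in some `Q s` an ideal. By the local
      -- hypothesis every point of the extension of `O` contains this ideal, so `enough-points`
      -- places `O` in it.
      compact : {A : Set a} {_∼_ : Rel A r} {S : Pred A p} → Directed _∼_ S →
        (Q : A → Pred X q) → (∀ {s t} → s ∼ t → Q s ⊆ Q t) → (o : O ∈ Ω₀) →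
        (∀ y → y ∋ o → ∃ λ s → s ∈ S × ∃ λ V → Σ (V ∈ Ω₀) λ v → y ∋ v × V ⊆ Q s) →
        ∃ λ s → s ∈ S × O ⊆ Q s
      compact {S = S} ((s₀ , s₀∈S) , bound) Q mono o local =
        unshrink (proj₂ (enough-points covered o λ y y∋o →
          let s , s∈S , V , v , y∋v , V⊆ = local y y∋o in
          upClosed y y∋v (↓≤ {I = covered} v (v , shrink (s , s∈S , V⊆)))))
        where
        covered : Ideal Ω₀
        covered = ideal (λ V → ∃ λ s → s ∈ S × V ⊆ Q s)
          (λ _ _ W⊆V (s , s∈S , V⊆) → s , s∈S , λ z → V⊆ (W⊆V z))
          (s₀ , s₀∈S , λ ())
          λ _ _ (s , s∈S , V⊆) (t , t∈S , W⊆) →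
            let u , u∈S , s∼u , t∼u = bound s∈S t∈S in
            u , u∈S , [ (λ z → mono s∼u (V⊆ z)) , (λ z → mono t∼u (W⊆ z)) ]

  -- The way-below relation in a bc-domain.

  module Domain {c ℓ₁ ℓ₂ ℓ} {D : Poset c ℓ₁ ℓ₂} (bc : IsBCDomain D ℓ)
                {D₀ : Pred (Poset.Carrier D) ℓ} (basis : IsBasis D ℓ D₀) where
    open Poset D
    open IsBCDomain bc

    private
      variable
        d j u v : Carrier

    _≪_ : Rel Carrier _
    _≪_ = WayBelow D ℓ

    -- The domain axioms quantify only over subsets with truth values in `Set ℓ`; this lemma and the
    -- next ones carry directed sets and joins to that universe and back.
    shrink-directed : {S : Pred Carrier p} → Directed _≤_ S → Directed _≤_ (Small ℓ ∘ S)
    shrink-directed ((s , s∈S) , bound) = (s , shrink s∈S) , λ s∈ t∈ →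
      let z , z∈S , s≤z , t≤z = bound (unshrink s∈) (unshrink t∈) in z , shrink z∈S , s≤z , t≤z

    shrink-join : {S : Pred Carrier p} → IsJoin D S j → IsJoin D (Small ℓ ∘ S) j
    shrink-join (ub , least) = ub ∘ unshrink , λ ub′ → least (ub′ ∘ shrink)

    unshrink-join : {S : Pred Carrier p} → IsJoin D (Small ℓ ∘ S) j → IsJoin D S j
    unshrink-join (ub , least) = ub ∘ shrink , λ ub′ → least (ub′ ∘ unshrink)

    directed-join : (S : Pred Carrier p) → Directed _≤_ S → ∃ (IsJoin D S)
    directed-join S dir = map₂ unshrink-join (dcpo _ (shrink-directed dir))

    bounded-join : (S : Pred Carrier p) → ∃ (IsUpperBound D S) → ∃ (IsJoin D S)
    bounded-join S (u , ub) = map₂ unshrink-join (boundedJoin _ (u , ub ∘ unshrink))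

    ≪-directed : {S : Pred Carrier p} → u ≪ v → Directed _≤_ S → IsJoin D S j → v ≤ j →
      ∃ λ s → s ∈ S × u ≤ s
    ≪-directed u≪v dir join v≤j
      with s , s∈S , u≤s ← u≪v _ (shrink-directed dir) (shrink-join join) v≤j = s , unshrink s∈S , u≤s

    ScottOpen-directed : {V : Pred Carrier ℓ} {S : Pred Carrier p} → V ∈ ScottOpen D ℓ →
      Directed _≤_ S → IsJoin D S j → j ∈ V → S ≬ V
    ScottOpen-directed (_ , meets) dir join j∈V
      with s , s∈S , s∈V ← meets _ (shrink-directed dir) (shrink-join join) j∈V
      = s , unshrink s∈S , s∈V

    ≪⇒≤ : u ≪ v → u ≤ v
    ≪⇒≤ {v = v} u≪v
      with _ , ≡.refl , u≤v ← ≪-directed {S = _≡ v} u≪v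
             ((v , ≡.refl) , λ { ≡.refl ≡.refl → v , ≡.refl , refl , refl })
             ((λ { ≡.refl → refl }) , λ ub → ub ≡.refl) refl
      = u≤v

    ≤-≪-trans : d ≤ u → u ≪ v → d ≪ v
    ≤-≪-trans d≤u u≪v S dir join v≤j =
      let s , s∈S , u≤s = u≪v S dir join v≤j in s , s∈S , trans d≤u u≤s

    ≪-≤-trans : d ≪ u → u ≤ v → d ≪ v
    ≪-≤-trans d≪u u≤v S dir join v≤j = d≪u S dir join (trans u≤v v≤j)

    -- v is the directed join of the elements a with a ≪ e ≪ v for some e in the basis.
    interpolate : u ≪ v → ∃ λ e → e ∈ D₀ × u ≪ e × e ≪ v
    interpolate {u} {v} u≪v =
      let _ , (e , e∈D₀ , a≪e , e≪v) , u≤a = ≪-directed u≪v directed join refl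
      in e , e∈D₀ , ≤-≪-trans u≤a a≪e , e≪v
      where
      Approx : Pred Carrier _
      Approx a = ∃ λ e → e ∈ D₀ × a ≪ e × e ≪ v

      below : ∀ {a a′ e} → e ∈ D₀ → e ≪ v → a ≪ e → a′ ≪ e → ∃ λ z → z ∈ Approx × a ≤ z × a′ ≤ z
      below {e = e} e∈D₀ e≪v a≪e a′≪e =
        let dir , join = proj₂ basis e
            s , s∈ , a≤s = ≪-directed a≪e dir join refl
            t , t∈ , a′≤t = ≪-directed a′≪e dir join refl
            z , (_ , z≪e) , s≤z , t≤z = proj₂ dir s∈ t∈
        in z , (e , e∈D₀ , z≪e , e≪v) , trans a≤s s≤z , trans a′≤t t≤z

      directed : Directed _≤_ Approx
      directed =
        (let (e , e∈D₀ , e≪v) , _ = proj₁ (proj₂ basis v)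
             (a , _ , a≪e) , _ = proj₁ (proj₂ basis e)
         in a , e , e∈D₀ , a≪e , e≪v) ,
        λ (e , e∈D₀ , a≪e , e≪v) (e′ , e′∈D₀ , a′≪e′ , e′≪v) →
          let z , (z∈D₀ , z≪v) , e≤z , e′≤z =
                proj₂ (proj₁ (proj₂ basis v)) (e∈D₀ , e≪v) (e′∈D₀ , e′≪v)
          in below z∈D₀ z≪v (≪-≤-trans a≪e e≤z) (≪-≤-trans a′≪e′ e′≤z)

      join : IsJoin D Approx v
      join = (λ (e , _ , a≪e , e≪v) → trans (≪⇒≤ a≪e) (≪⇒≤ e≪v)) , λ ub →
        proj₂ (proj₂ (proj₂ basis v)) λ {e} (e∈D₀ , e≪v) →
          proj₂ (proj₂ (proj₂ basis e)) λ (_ , a≪e) → ub (e , e∈D₀ , a≪e , e≪v)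

    ⇑ : Carrier → Pred Carrier ℓ
    ⇑ u v = Small ℓ (u ≪ v)

    -- An interpolant `e` between `u` and the join lies below some member of `S`, which is then way
    -- above `u`.
    ⇑-ScottOpen : ∀ u → ⇑ u ∈ ScottOpen D ℓ
    ⇑-ScottOpen u =
      (λ u≪v v≤w → shrink (≪-≤-trans (unshrink u≪v) v≤w)) ,
      λ S dir join u≪j →
        let e , _ , u≪e , e≪j = interpolate (unshrink u≪j)
            s , s∈S , e≤s = e≪j S dir join refl
        in s , s∈S , shrink (≪-≤-trans u≪e e≤s)

  -- Step functions on the space.

  module Completion {x c ℓ₁ ℓ₂ ℓ} {X : Set x} {τ : Topology X ℓ} {Ω₀ : Pred (Pred X ℓ) ℓ}
                    (viable : IsViableBase τ Ω₀) {D : Poset c ℓ₁ ℓ₂} (bc : IsBCDomain D ℓ)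
                    {D₀ : Pred (Poset.Carrier D) ℓ} (basis : IsBasis D ℓ D₀)
                    (zorn : ∀ {c ℓ₁ ℓ₂ ℓ} → Zorn c ℓ₁ ℓ₂ ℓ) where
    open Poset D
    open IsBCDomain bc using (⊥; ⊥-minimum)
    open IsViableBase viable using (∅-mem; U-mem; ∩-closed)
    open Spectrum viable
    open Domain bc basis

    private
      variable
        g h : X → Carrier
        W : Pred X ℓ

      𝔹 : Pred (X → Carrier) _
      𝔹 = 𝔹abs Ω₀ D bc D₀

      _⋖_ : Rel (X → Carrier) _
      _⋖_ = _≺_ Ω₀ D bc D₀

      𝓦 : Set _
      𝓦 = RoundedIdeal Ω₀ D bc D₀

      _≲_ : Rel 𝓦 _
      _≲_ = Poset._≤_ (RoundedIdealCompletion Ω₀ D bc D₀)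

      open RoundedIdeal using (member)

    module _ (P : 𝔹 g) where
      open Presentation P

      -- With `join≤`, this presents `g z` as the join of the `b i` with `z ∈ O i`, so later
      -- arguments can bypass the functions `bχO`.
      step≤join : ∀ {i z} → z ∈ O i → b i ≤ g z
      step≤join {i} {z} z∈O =
        trans (reflexive (Eq.sym (proj₁ (isStep i z) z∈O))) (proj₁ (isJoin z) (i , Eq.refl))

      join≤ : ∀ {z u} → (∀ i → z ∈ O i → b i ≤ u) → g z ≤ u
      join≤ {z} {u} ub = proj₂ (isJoin z) λ (i , d≈) → trans (reflexive d≈) (value≤ i)
        where
        value≤ : ∀ i → bχO i z ≤ u
        value≤ i with em {P = z ∈ O i}
        ... | yes z∈O = trans (reflexive (proj₁ (isStep i z) z∈O)) (ub i z∈O)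
        ... | no z∉O = trans (reflexive (proj₂ (isStep i z) z∉O)) (⊥-minimum u)

      -- z is chosen such that g z is at most the value at y of the extension of g to the
      -- spectrum.
      sample : ∀ y (w : W ∈ Ω₀) → y ∋ w →
        ∃ λ z → z ∈ W × (∀ {u} → (∀ i → y ∋ O∈Ω₀ i → b i ≤ u) → g z ≤ u)
      sample y w y∋w =
        let z , z∈W , _ , O⊆y = patch-dense y O O∈Ω₀ w y∋w ∅-mem (∌-∅ y) in
        z , z∈W , λ ub → join≤ λ i z∈O → ub i (O⊆y i z∈O)

    ⋖⇒≤ : g ⋖ h → ∀ z → g z ≤ h z
    ⋖⇒≤ (P , below) z = join≤ P λ i z∈O → ≪⇒≤ (below i z∈O)

    ⋖-≤-trans : g ⋖ h → ∀ {k} → (∀ z → h z ≤ k z) → g ⋖ k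
    ⋖-≤-trans (P , below) h≤k = P , λ i z∈O → ≪-≤-trans (below i z∈O) (h≤k _)

    -- From rounded ideals to continuous functions.

    module _ (R : 𝓦) where
      private
        member-bound = proj₂ (RoundedIdeal.directed R)

      Approx : Spec Ω₀ → Pred Carrier _
      Approx y u = ∃ λ g → g ∈ member R ×
        ∃ λ V → Σ (V ∈ Ω₀) λ v → y ∋ v × (∀ {z} → z ∈ V → u ≤ g z)

      Approx-directed : ∀ y → Directed _≤_ (Approx y)
      Approx-directed y = (⊥ , ⊥-approx) , λ {s} {t} → bound s t
        where
        ⊥-approx : ⊥ ∈ Approx y
        ⊥-approx =
          let g , g∈R = proj₁ (RoundedIdeal.directed R)
              K , K∈y = CompletelyPrimeFilter.nonempty y
              _ , _ , v , y∋v = ∋-basic y K K∈y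
          in g , g∈R , U , U-mem , ∋-mono y v U-mem _ y∋v , λ {z} _ → ⊥-minimum (g z)

        bound : ∀ s t → s ∈ Approx y → t ∈ Approx y → ∃ λ u → u ∈ Approx y × s ≤ u × t ≤ u
        bound s t (g , g∈R , V , v , y∋v , s≤g) (h , h∈R , W , w , y∋w , t≤h) =
          -- `V ∩ W` lies in the filter `y` and so is inhabited. At such a `z` the value `k z`
          -- bounds `s` and `t`; their join then exists and stays below `k` on all of `V ∩ W`.
          let z , z∈ , _ = ⊈-witness {P = V ∩ W} {Q = ∅ {ℓ = ℓ}} λ V∩W⊆∅ →
                ∌-∅ y (∋-mono y (∩-closed v w) ∅-mem V∩W⊆∅ y∋v∩w)
              u , ub , least = bounded-join (λ d → d ≡ s ⊎ d ≡ t) (k z , k-bound z∈)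
          in u , (k , k∈R , V ∩ W , ∩-closed v w , y∋v∩w , λ z∈ → least (k-bound z∈))
               , ub (inj₁ ≡.refl) , ub (inj₂ ≡.refl)
          where
          upper = member-bound g∈R h∈R
          k = proj₁ upper
          k∈R = proj₁ (proj₂ upper)
          y∋v∩w = ∋-∩ y v w y∋v y∋w

          k-bound : ∀ {z} → z ∈ (V ∩ W) → IsUpperBound D (λ d → d ≡ s ⊎ d ≡ t) (k z)
          k-bound (z∈V , _) (inj₁ ≡.refl) = trans (s≤g z∈V) (⋖⇒≤ (proj₁ (proj₂ (proj₂ upper))) _)
          k-bound (_ , z∈W) (inj₂ ≡.refl) = trans (t≤h z∈W) (⋖⇒≤ (proj₂ (proj₂ (proj₂ upper))) _)

      limit : Spec Ω₀ → Carrier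
      limit y = proj₁ (directed-join (Approx y) (Approx-directed y))

      limit-isJoin : ∀ y → IsJoin D (Approx y) (limit y)
      limit-isJoin y = proj₂ (directed-join (Approx y) (Approx-directed y))

      -- Some approximant at `y` already lies in the Scott-open set, and it is an approximant at
      -- every other point of the extension of its `W`.
      limit-continuous : Continuous (SpecOpen Ω₀) (ScottOpen D ℓ) limit
      limit-continuous {V} V-open = openFromBasic (limit ⊢ V) λ {y} limit∈V →
        let u , (g , g∈R , W , w , y∋w , u≤g) , u∈V =
              ScottOpen-directed V-open (Approx-directed y) (limit-isJoin y) limit∈V
        in W , w , y∋w , λ {y′} y′∋w →
             proj₁ V-open u∈V (proj₁ (limit-isJoin y′) (g , g∈R , W , w , y′∋w , u≤g))

    limit-mono : ∀ {R S} → R ≲ S → ∀ y → limit R y ≤ limit S y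
    limit-mono {R} {S} R⊆S y = proj₂ (limit-isJoin R y) λ (g , g∈R , rest) →
      proj₁ (limit-isJoin S y) (g , R⊆S g∈R , rest)

    -- This is the spectral form of `≺`, with each `O i` replaced by the compact open set that
    -- extends it.
    Below : (Spec Ω₀ → Carrier) → 𝔹 g → Set _
    Below f P = ∀ i y → y ∋ O∈Ω₀ i → b i ≪ f y
      where open Presentation P

    -- The relation `g ⋖ h` speaks of points of `X` only; density yields `z ∈ O i` at which `h z` is
    -- at most `limit R y`.
    ⋖-Below : (R : 𝓦) → h ∈ member R → ((P , _) : g ⋖ h) → Below (limit R) P
    ⋖-Below R h∈R (P , g⋖h) i y y∋O =
      let Q = RoundedIdeal.⊆𝔹abs R h∈R
          open Presentation Q
          z , z∈O , hz≤ = sample Q y (Presentation.O∈Ω₀ P i) y∋O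
      in ≪-≤-trans (g⋖h i z∈O) (hz≤ λ j y∋Oj →
           proj₁ (limit-isJoin R y) (_ , h∈R , O j , O∈Ω₀ j , y∋Oj , step≤join Q))

    -- Around each `y`, interpolation and the directed join defining `limit R y` yield an `h` in `R`
    -- way above `b i` on a basic set. Compactness gives one `h` per index and finite selection one
    -- for all indices, so that `g ⋖ h`.
    Below-member : (R : 𝓦) (P : 𝔹 g) → Below (limit R) P → g ∈ member R
    Below-member R P below =
      let h , h∈R , O⊆ = finite-selection directed (λ i h → O i ⊆ (h ⊢ (b i ≪_)))
            (λ s⋖t O⊆ z∈O → ≪-≤-trans (O⊆ z∈O) (⋖⇒≤ s⋖t _)) covered
      in downClosed h∈R (P , O⊆)
      where
      open Presentation P
      open RoundedIdeal R using (directed; downClosed)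

      covered : ∀ i → member R ≬ λ h → O i ⊆ (h ⊢ (b i ≪_))
      covered i = compact zorn directed (λ h → h ⊢ (b i ≪_))
        (λ s⋖t {z} b≪s → ≪-≤-trans b≪s (⋖⇒≤ s⋖t z)) (O∈Ω₀ i) λ y y∋O →
          let e , _ , b≪e , e≪limit = interpolate (below i y y∋O)
              u , (h , h∈R , V , v , y∋v , u≤h) , e≤u =
                ≪-directed e≪limit (Approx-directed R y) (limit-isJoin R y) refl
          in h , h∈R , V , v , y∋v , λ z∈V → ≪-≤-trans b≪e (trans e≤u (u≤h z∈V))

    limit-cancel : ∀ {R S} → (∀ y → limit R y ≤ limit S y) → R ≲ S
    limit-cancel {R} {S} R≤S g∈R =
      -- Roundedness: directedness applied to `g` twice provides an `h` in `R` with `g ⋖ h`.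
      let h , h∈R , g⋖h , _ = proj₂ (RoundedIdeal.directed R) g∈R g∈R
      in Below-member S (proj₁ g⋖h) λ i y y∋O → ≪-≤-trans (⋖-Below R h∈R g⋖h i y y∋O) (R≤S y)

    -- From continuous functions to rounded ideals.

    module _ (f : Spec Ω₀ → Carrier)
             (f-continuous : Continuous (SpecOpen Ω₀) (ScottOpen D ℓ) f) where

      -- A single step way below `f` on the spectrum. Finite lists of pieces, directed under
      -- inclusion, index the step functions approximating `f`.
      record Piece : Set (x ⊔ c ⊔ ℓ₂ ⊔ Level.suc ℓ) where
        field
          value     : Carrier
          domain    : Pred X ℓ
          value∈D₀  : value ∈ D₀
          domain∈Ω₀ : domain ∈ Ω₀
          below     : ∀ y → y ∋ domain∈Ω₀ → value ≪ f y

      open Piece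

      -- The preimage under `f` of the Scott-open set `⇑ u` is open, so it contains the extension of
      -- a basic set around `y`.
      piece : ∀ {y u} → u ∈ D₀ → u ≪ f y → Σ Piece λ p → value p ≡ u × y ∋ domain∈Ω₀ p
      piece {y} {u} u∈D₀ u≪fy =
        let V , v , y∋v , v⊆ = basicInOpen (f-continuous (⇑-ScottOpen u)) {y} (shrink u≪fy)
        in record { value = u ; domain = V ; value∈D₀ = u∈D₀ ; domain∈Ω₀ = v
                  ; below = λ y′ y′∋v → unshrink (v⊆ {y′} y′∋v) } , ≡.refl , y∋v

      module _ (l : List Piece) where

        Values : X → Pred Carrier _
        Values z d = ∃ λ p → p ∈ˡ l × z ∈ domain p × d ≡ value p

        -- The point `η z` lies in the extension of every domain containing `z`. This bound makes
        -- the joins in `glue` exist and the family of pieces consistent.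
        Values-bounded : ∀ z → IsUpperBound D (Values z) (f (η z))
        Values-bounded z (p , _ , z∈p , ≡.refl) = ≪⇒≤ (below p (η z) (η-∋ (domain∈Ω₀ p) z∈p))

        glue : X → Carrier
        glue z = proj₁ (bounded-join (Values z) (f (η z) , Values-bounded z))

        glue-isJoin : ∀ z → IsJoin D (Values z) (glue z)
        glue-isJoin z = proj₂ (bounded-join (Values z) (f (η z) , Values-bounded z))

        value≤glue : ∀ {p z} → p ∈ˡ l → z ∈ domain p → value p ≤ glue z
        value≤glue {p} {z} p∈l z∈p = proj₁ (glue-isJoin z) (p , p∈l , z∈p , ≡.refl)

        glue-presentation : 𝔹 glue
        glue-presentation = record
          { size       = length l
          ; b          = value ∘ at
          ; O          = domain ∘ at
          ; b∈D₀       = value∈D₀ ∘ at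
          ; O∈Ω₀       = domain∈Ω₀ ∘ at
          ; consistent = λ J (z , z∈O) → f (η z) , λ {j} j∈J →
              Values-bounded z (at j , ∈-lookup j , z∈O j∈J , ≡.refl)
          ; bχO        = step
          ; isStep     = λ i z → step-in i , step-out i
          ; isJoin     = λ z →
              (λ (i , d≈) → trans (reflexive d≈) (step≤ i z)) ,
              λ ub → proj₂ (glue-isJoin z) λ { (p , p∈l , z∈p , ≡.refl) →
                ≤-step p∈l z∈p (λ i → ub (i , Eq.refl)) }
          }
          where
          at : Fin (length l) → Piece
          at = lookup l

          step : Fin (length l) → X → Carrier
          step i z = if does (em {P = z ∈ domain (at i)}) then value (at i) else ⊥

          step-in : ∀ i {z} → z ∈ domain (at i) → step i z ≈ value (at i)
          step-in i {z} z∈ with em {P = z ∈ domain (at i)}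
          ... | yes _ = Eq.refl
          ... | no z∉ = ⊥-elim (z∉ z∈)

          step-out : ∀ i {z} → z ∉ domain (at i) → step i z ≈ ⊥
          step-out i {z} z∉ with em {P = z ∈ domain (at i)}
          ... | yes z∈ = ⊥-elim (z∉ z∈)
          ... | no _ = Eq.refl

          step≤ : ∀ i z → step i z ≤ glue z
          step≤ i z with em {P = z ∈ domain (at i)}
          ... | yes z∈ = value≤glue (∈-lookup i) z∈
          ... | no _ = ⊥-minimum (glue z)

          ≤-step : ∀ {p z u} → p ∈ˡ l → z ∈ domain p → (∀ i → step i z ≤ u) → value p ≤ u
          ≤-step {p} {z} p∈l z∈p ub with index p∈l | lookup-index p∈l
          ... | i | ≡.refl = trans (reflexive (Eq.sym (step-in i z∈p))) (ub i)

        glue-Below : Below f glue-presentation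
        glue-Below i = below (lookup l i)

      glue-mono : ∀ {l l′} → l ⊆ˡ l′ → ∀ z → glue l z ≤ glue l′ z
      glue-mono {l} {l′} l⊆l′ z = proj₂ (glue-isJoin l z) λ (p , p∈l , rest) →
        proj₁ (glue-isJoin l′ z) (p , l⊆l′ p∈l , rest)

      ⊆ˡ-directed : Directed {A = List Piece} _⊆ˡ_ (U {ℓ = ℓ})
      ⊆ˡ-directed = ([] , _) , λ {l} {l′} _ _ → l ++ l′ , _ , xs⊆xs++ys l l′ , xs⊆ys++xs l′ l

      -- Interpolating `b i ≪ e ≪ f y` gives a one-piece list with value `e` near `y`; compactness
      -- yields a list for each `i`, and directedness one list for all.
      ⋖-glue : (P : 𝔹 g) → Below f P → ∃ λ l → g ⋖ glue l
      ⋖-glue P P-below =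
        let l , _ , O⊆ = finite-selection ⊆ˡ-directed (λ i l → O i ⊆ (glue l ⊢ (b i ≪_)))
              (λ l⊆l′ O⊆ z∈O → ≪-≤-trans (O⊆ z∈O) (glue-mono l⊆l′ _)) covered
        in l , P , O⊆
        where
        open Presentation P

        covered : ∀ i → U {ℓ = ℓ} ≬ λ (l : List Piece) → O i ⊆ (glue l ⊢ (b i ≪_))
        covered i = compact zorn ⊆ˡ-directed (λ l → glue l ⊢ (b i ≪_))
          (λ l⊆l′ {z} b≪ → ≪-≤-trans b≪ (glue-mono l⊆l′ z)) (O∈Ω₀ i) λ y y∋O →
            let e , e∈D₀ , b≪e , e≪fy = interpolate (P-below i y y∋O)
                p , p≡e , y∋p = piece e∈D₀ e≪fy
            in p ∷ [] , _ , domain p , domain∈Ω₀ p , y∋p , λ z∈p →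
                 ≪-≤-trans b≪e (trans (reflexive (Eq.reflexive (≡.sym p≡e)))
                   (value≤glue (p ∷ []) (here ≡.refl) z∈p))

      Below-sample : (P : 𝔹 g) → Below f P →
        ∀ y (w : W ∈ Ω₀) → y ∋ w → ∃ λ z → z ∈ W × g z ≤ f y
      Below-sample P P-below y w y∋w =
        let z , z∈W , gz≤ = sample P y w y∋w in
        z , z∈W , gz≤ λ i y∋O → ≪⇒≤ (P-below i y y∋O)

      approximants : 𝓦
      approximants = record
        { member     = λ g → Small ℓ (Σ (𝔹 g) (Below f))
        ; ⊆𝔹abs      = proj₁ ∘ unshrink
        ; downClosed = λ h∈ (P , g⋖h) → let Q , Q-below = unshrink h∈ in
            shrink (P , λ i y y∋O →
              let z , z∈O , hz≤fy = Below-sample Q Q-below y (Presentation.O∈Ω₀ P i) y∋O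
              in ≪-≤-trans (g⋖h i z∈O) hz≤fy)
        ; directed   = (glue [] , glue∈ []) , λ g∈ h∈ →
            let P , P-below = unshrink g∈
                Q , Q-below = unshrink h∈
                l , g⋖l = ⋖-glue P P-below
                l′ , h⋖l′ = ⋖-glue Q Q-below
            -- The concatenated list glues to a function above both; all its pieces lie below `f`,
            -- so they are again consistent.
            in glue (l ++ l′) , glue∈ (l ++ l′)
                 , ⋖-≤-trans g⋖l (glue-mono (xs⊆xs++ys l l′))
                 , ⋖-≤-trans h⋖l′ (glue-mono (xs⊆ys++xs l′ l))
        }
        where
        glue∈ : ∀ l → Small ℓ (Σ (𝔹 (glue l)) (Below f))
        glue∈ l = shrink (glue-presentation l , glue-Below l)

      -- An approximant `u` is compared with `f y` at a sampled point of `V`. Conversely, each basis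
      -- element way below `f y` is the value of a single piece around `y`.
      limit-approximants : ∀ y → limit approximants y ≈ f y
      limit-approximants y = antisym
        (proj₂ (limit-isJoin approximants y) λ (g , g∈ , V , v , y∋v , u≤g) →
          let P , P-below = unshrink g∈
              z , z∈V , gz≤fy = Below-sample P P-below y v y∋v
          in trans (u≤g z∈V) gz≤fy)
        (proj₂ (proj₂ (proj₂ basis (f y))) λ (u∈D₀ , u≪fy) →
          let p , p≡u , y∋p = piece u∈D₀ u≪fy
              l = p ∷ []
          in proj₁ (limit-isJoin approximants y)
               ( glue l , shrink (glue-presentation l , glue-Below l)
               , domain p , domain∈Ω₀ p , y∋p
               , λ z∈p → trans (reflexive (Eq.reflexive (≡.sym p≡u)))
                   (value≤glue l (here ≡.refl) z∈p) ))

    -- The order isomorphism.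

    limit-iso : OrderIsomorphic (RoundedIdealCompletion Ω₀ D bc D₀) (FunctionSpace Ω₀ D)
    limit-iso = (λ R → limit R , limit-continuous R) , record
      { isOrderMonomorphism = record
        { isOrderHomomorphism = record
          { cong = λ {R} {S} → cong {R} {S}
          ; mono = λ {R} {S} → limit-mono {R} {S}
          }
        ; injective = λ {R} {S} R≈S →
            limit-cancel {R} {S} (reflexive ∘ R≈S) ,
            limit-cancel {S} {R} (reflexive ∘ Eq.sym ∘ R≈S)
        ; cancel = λ {R} {S} → limit-cancel {R} {S}
        }
      ; surjective = λ (f , f-continuous) → approximants f f-continuous , λ {R} R≈ y →
          Eq.trans (cong {R} {approximants f f-continuous} R≈ y)
            (limit-approximants f f-continuous y)
      }
      where
      cong : ∀ {R S} → R ≲ S × S ≲ R → ∀ y → limit R y ≈ limit S y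
      cong {R} {S} (R⊆S , S⊆R) y = antisym (limit-mono {R} {S} R⊆S y) (limit-mono {S} {R} S⊆R y)

mainTheorem19 : (∀ {ℓ} → ExcludedMiddle ℓ) →
    (∀ {c ℓ₁ ℓ₂ ℓ} → Zorn c ℓ₁ ℓ₂ ℓ) →
    ∀ {x c ℓ₁ ℓ₂ ℓ} {X : Set x} (τ : Topology X ℓ) (Ω₀ : Pred (Pred X ℓ) ℓ) →
    IsViableBase τ Ω₀ →
    (D : Poset c ℓ₁ ℓ₂) (bc : IsBCDomain D ℓ) (D₀ : Pred (Poset.Carrier D) ℓ) →
    IsBasis D ℓ D₀ →
    OrderIsomorphic (RoundedIdealCompletion Ω₀ D bc D₀) (FunctionSpace Ω₀ D)
mainTheorem19 em zorn τ Ω₀ viable D bc D₀ basis =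
  Classical.Completion.limit-iso em viable bc basis zorn
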